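{- The set of axioms $\mathcal{R}=\{$(R1), (R2), (R3), (R4), (R5), (R6), (R8$'$), (R9), (R10)$\}$ is independent. That is, for each axiom $\varphi$ in $\mathcal{R}$, $\varphi$ is not derivable from the other axioms of $\mathcal{R}$: there is an algebra $(A,+,-,;,{}^{\smile},1')$ in which $\varphi$ fails and in which all the other axioms of $\mathcal{R}$ are valid.
   Context: All algebras have the form $\mathfrak{A}=(A,+,-,;,{}^{\smile},1')$, where $A$ is a non-empty set, $+$ and $;$ are binary operations on $A$, $-$ and ${}^{\smile}$ are unary operations on $A$, and $1'$ is a distinguished element of $A$. Unary operations bind more tightly than binary ones, and $;$ binds more tightly than $+$. An axiom is valid in $\mathfrak{A}$ if it holds for all elements $r,s,t\in A$; otherwise it fails in $\mathfrak{A}$. The axioms of $\mathcal{R}$ are: (R1) $r+s=s+r$; (R2) $r+(s+t)=(r+s)+t$; (R3) $-(-r+s)+-(-r+-s)=r$; (R4) $r;(s;t)=(r;s);t$; (R5) $r;1'=r$; (R6) $(r^{\smile})^{\smile}=r$; (R8$'$) $r;(s+t)=r;s+r;t$; (R9) $(r+s)^{\smile}=r^{\smile}+s^{\smile}$; (R10) $r^{\smile};-(r;s)+-s=-s$, i.e. $\bigl((r^{\smile});(-(r;s))\bigr)+(-s)=-s$. A set of axioms is independent if none of the axioms in it can be derived from the remaining ones; for each axiom this is witnessed by a model in which that axiom fails and all the remaining axioms are valid. -}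

module Defs where

open import Algebra.Core using (Op₁; Op₂)
open import Data.Nat.Base using (ℕ)
open import Data.Product.Base using (Σ; _×_)
open import Relation.Binary.PropositionalEquality using (_≡_; _≢_)
open import Relation.Nullary.Negation using (¬_)

-- Non-emptiness of the carrier is witnessed by 1′.
record Algebra : Set₁ where
  infix  9 _˘
  infix  9 -_
  infixl 7 _⨾_
  infixl 6 _+_
  field
    Carrier : Set
    _+_     : Op₂ Carrier
    -_      : Op₁ Carrier
    _⨾_     : Op₂ Carrier
    _˘      : Op₁ Carrier
    1′      : Carrier

infix  9 _˘
infix  9 -_
infixl 7 _⨾_
infixl 6 _+_
infix  4 _≈_

data Term : Set where
  var : ℕ → Term
  _+_ : Op₂ Term
  -_  : Op₁ Term
  _⨾_ : Op₂ Term
  _˘  : Op₁ Term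
  1′  : Term

data Equation : Set where
  _≈_ : Term → Term → Equation

⟦_⟧ : Term → (𝔄 : Algebra) → (ℕ → Algebra.Carrier 𝔄) → Algebra.Carrier 𝔄
⟦ var x ⟧ 𝔄 ρ = ρ x
⟦ p + q ⟧ 𝔄 ρ = Algebra._+_ 𝔄 (⟦ p ⟧ 𝔄 ρ) (⟦ q ⟧ 𝔄 ρ)
⟦ - p   ⟧ 𝔄 ρ = Algebra.-_  𝔄 (⟦ p ⟧ 𝔄 ρ)
⟦ p ⨾ q ⟧ 𝔄 ρ = Algebra._⨾_ 𝔄 (⟦ p ⟧ 𝔄 ρ) (⟦ q ⟧ 𝔄 ρ)
⟦ p ˘   ⟧ 𝔄 ρ = Algebra._˘  𝔄 (⟦ p ⟧ 𝔄 ρ)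
⟦ 1′    ⟧ 𝔄 ρ = Algebra.1′  𝔄

ValidIn FailsIn : Algebra → Equation → Set
ValidIn 𝔄 (p ≈ q) = ∀ ρ → ⟦ p ⟧ 𝔄 ρ ≡ ⟦ q ⟧ 𝔄 ρ
FailsIn 𝔄 e       = ¬ ValidIn 𝔄 e

_[_] : Term → (ℕ → Term) → Term
var x   [ σ ] = σ x
(p + q) [ σ ] = (p [ σ ]) + (q [ σ ])
(- p)   [ σ ] = - (p [ σ ])
(p ⨾ q) [ σ ] = (p [ σ ]) ⨾ (q [ σ ])
(p ˘)   [ σ ] = (p [ σ ]) ˘
1′      [ σ ] = 1′

infix 3 _⊢_

-- Birkhoff's equational logic.
data _⊢_ (E : Equation → Set) : Equation → Set where
  axiom   : ∀ {p q} → E (p ≈ q) → ∀ σ → E ⊢ p [ σ ] ≈ q [ σ ]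
  ≈-refl  : ∀ {p} → E ⊢ p ≈ p
  ≈-sym   : ∀ {p q} → E ⊢ p ≈ q → E ⊢ q ≈ p
  ≈-trans : ∀ {p q u} → E ⊢ p ≈ q → E ⊢ q ≈ u → E ⊢ p ≈ u
  +-cong  : ∀ {p p′ q q′} → E ⊢ p ≈ p′ → E ⊢ q ≈ q′ → E ⊢ p + q ≈ p′ + q′
  -‿cong  : ∀ {p p′} → E ⊢ p ≈ p′ → E ⊢ - p ≈ - p′
  ⨾-cong  : ∀ {p p′ q q′} → E ⊢ p ≈ p′ → E ⊢ q ≈ q′ → E ⊢ p ⨾ q ≈ p′ ⨾ q′
  ˘-cong  : ∀ {p p′} → E ⊢ p ≈ p′ → E ⊢ p ˘ ≈ p′ ˘

private
  r s t : Term
  r = var 0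
  s = var 1
  t = var 2

data 𝓡 : Equation → Set where
  R1  : 𝓡 (r + s ≈ s + r)
  R2  : 𝓡 (r + (s + t) ≈ (r + s) + t)
  R3  : 𝓡 (- (- r + s) + - (- r + - s) ≈ r)
  R4  : 𝓡 (r ⨾ (s ⨾ t) ≈ (r ⨾ s) ⨾ t)
  R5  : 𝓡 (r ⨾ 1′ ≈ r)
  R6  : 𝓡 ((r ˘) ˘ ≈ r)
  R8′ : 𝓡 (r ⨾ (s + t) ≈ r ⨾ s + r ⨾ t)
  R9  : 𝓡 ((r + s) ˘ ≈ r ˘ + s ˘)
  R10 : 𝓡 (r ˘ ⨾ - (r ⨾ s) + - s ≈ - s)

infixl 5 _∖_

_∖_ : (Equation → Set) → Equation → Equation → Set
(E ∖ φ) ψ = E ψ × ψ ≢ φ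

_⊨_ : Algebra → (Equation → Set) → Set
𝔄 ⊨ E = ∀ ψ → E ψ → ValidIn 𝔄 ψ

Independent : (Equation → Set) → Set
Independent E = ∀ φ → E φ → ¬ (E ∖ φ ⊢ φ)

IndependenceModel : (Equation → Set) → Equation → Set₁
IndependenceModel E φ = Σ Algebra λ 𝔄 → FailsIn 𝔄 φ × 𝔄 ⊨ (E ∖ φ)

{-# OPTIONS --safe #-}
-- Each axiom is separated from the others by a model with at most eight
-- elements, in which all the identities are decided by exhaustive evaluation;
-- underivability then follows from the soundness of equational logic.
module Submission where

open import Defs
open import Data.Bool.Base using (Bool; true; false; _∧_; _∨_; _xor_; not; if_then_else_)
import Data.Bool.Properties as Bool
open import Data.Fin.Base using (Fin; opposite)
open import Data.Fin.Patterns using (0F; 1F; 2F; 3F; 4F; 5F; 6F; 7F; 8F)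
import Data.Fin.Properties as Fin
open import Data.Fin.Subset using (Subset; _∪_; ∁; ∣_∣)
open import Data.Nat.Base using (ℕ; zero; suc; _≡ᵇ_)
open import Data.Product.Base using (_×_; _,_; proj₁; proj₂; ∃)
open import Data.Vec.Base using (Vec; []; _∷_; lookup)
open import Data.Vec.Properties using (≡-dec)
open import Function.Base using (id; const; _∘_)
open import Relation.Binary.Definitions using (DecidableEquality)
open import Relation.Binary.PropositionalEquality
  using (_≡_; _≢_; refl; sym; trans; cong; cong₂; subst)
open import Relation.Nullary using (Dec; True; toWitness; map′; ¬?; _×-dec_; _→-dec_)
open import Relation.Unary using (Decidable)

-- Serves the `axiom` rule: an instance under `σ` holds at `ρ` because the axiom holds at the values
-- of `σ` under `ρ`.
⟦⟧-subst : ∀ 𝔄 p σ ρ → ⟦ p [ σ ] ⟧ 𝔄 ρ ≡ ⟦ p ⟧ 𝔄 (λ x → ⟦ σ x ⟧ 𝔄 ρ)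
⟦⟧-subst 𝔄 (var x) σ ρ = refl
⟦⟧-subst 𝔄 (p + q) σ ρ = cong₂ (Algebra._+_ 𝔄) (⟦⟧-subst 𝔄 p σ ρ) (⟦⟧-subst 𝔄 q σ ρ)
⟦⟧-subst 𝔄 (- p)   σ ρ = cong (Algebra.-_ 𝔄) (⟦⟧-subst 𝔄 p σ ρ)
⟦⟧-subst 𝔄 (p ⨾ q) σ ρ = cong₂ (Algebra._⨾_ 𝔄) (⟦⟧-subst 𝔄 p σ ρ) (⟦⟧-subst 𝔄 q σ ρ)
⟦⟧-subst 𝔄 (p ˘)   σ ρ = cong (Algebra._˘ 𝔄) (⟦⟧-subst 𝔄 p σ ρ)
⟦⟧-subst 𝔄 1′      σ ρ = refl

soundness : ∀ {E φ} 𝔄 → 𝔄 ⊨ E → E ⊢ φ → ValidIn 𝔄 φ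
soundness 𝔄 m (axiom {p} {q} e σ) ρ =
  trans (⟦⟧-subst 𝔄 p σ ρ) (trans (m _ e _) (sym (⟦⟧-subst 𝔄 q σ ρ)))
soundness 𝔄 m ≈-refl        ρ = refl
soundness 𝔄 m (≈-sym d)     ρ = sym (soundness 𝔄 m d ρ)
soundness 𝔄 m (≈-trans d e) ρ = trans (soundness 𝔄 m d ρ) (soundness 𝔄 m e ρ)
soundness 𝔄 m (+-cong d e)  ρ = cong₂ (Algebra._+_ 𝔄) (soundness 𝔄 m d ρ) (soundness 𝔄 m e ρ)
soundness 𝔄 m (-‿cong d)    ρ = cong (Algebra.-_ 𝔄) (soundness 𝔄 m d ρ)
soundness 𝔄 m (⨾-cong d e)  ρ = cong₂ (Algebra._⨾_ 𝔄) (soundness 𝔄 m d ρ) (soundness 𝔄 m e ρ)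
soundness 𝔄 m (˘-cong d)    ρ = cong (Algebra._˘ 𝔄) (soundness 𝔄 m d ρ)

models⇒independent : ∀ {E} → (∀ φ → E φ → IndependenceModel E φ) → Independent E
models⇒independent models φ e d =
  let 𝔄 , fails , m = models φ e in fails (soundness 𝔄 m d)

-- Numbering the axioms turns "all the others are valid" into a decidable quantifier over `Fin 9`.
axioms : Vec (∃ 𝓡) 9
axioms = (_ , R1) ∷ (_ , R2) ∷ (_ , R3) ∷ (_ , R4) ∷ (_ , R5)
       ∷ (_ , R6) ∷ (_ , R8′) ∷ (_ , R9) ∷ (_ , R10) ∷ []

equation : Fin 9 → Equation
equation i = proj₁ (lookup axioms i)

index : ∀ {φ} → 𝓡 φ → Fin 9
index R1  = 0F
index R2  = 1F
index R3  = 2F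
index R4  = 3F
index R5  = 4F
index R6  = 5F
index R8′ = 6F
index R9  = 7F
index R10 = 8F

lookup-index : ∀ {φ} (e : 𝓡 φ) → lookup axioms (index e) ≡ (φ , e)
lookup-index R1  = refl
lookup-index R2  = refl
lookup-index R3  = refl
lookup-index R4  = refl
lookup-index R5  = refl
lookup-index R6  = refl
lookup-index R8′ = refl
lookup-index R9  = refl
lookup-index R10 = refl

valuation : ∀ {A : Set} → A → A → A → ℕ → A
valuation x y z 0 = x
valuation x y z 1 = y
valuation x y z _ = z

ValidIn₃ : Algebra → Equation → Set
ValidIn₃ 𝔄 (p ≈ q) = ∀ x y z → ⟦ p ⟧ 𝔄 (valuation x y z) ≡ ⟦ q ⟧ 𝔄 (valuation x y z)

-- Every axiom only mentions the variables 0, 1 and 2, so that, axiom by axiom,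
-- both sides evaluate to the same thing at ρ and at its truncation.
valid₃⇒valid : ∀ {φ} 𝔄 → 𝓡 φ → ValidIn₃ 𝔄 φ → ValidIn 𝔄 φ
valid₃⇒valid 𝔄 R1  v ρ = v (ρ 0) (ρ 1) (ρ 2)
valid₃⇒valid 𝔄 R2  v ρ = v (ρ 0) (ρ 1) (ρ 2)
valid₃⇒valid 𝔄 R3  v ρ = v (ρ 0) (ρ 1) (ρ 2)
valid₃⇒valid 𝔄 R4  v ρ = v (ρ 0) (ρ 1) (ρ 2)
valid₃⇒valid 𝔄 R5  v ρ = v (ρ 0) (ρ 1) (ρ 2)
valid₃⇒valid 𝔄 R6  v ρ = v (ρ 0) (ρ 1) (ρ 2)
valid₃⇒valid 𝔄 R8′ v ρ = v (ρ 0) (ρ 1) (ρ 2)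
valid₃⇒valid 𝔄 R9  v ρ = v (ρ 0) (ρ 1) (ρ 2)
valid₃⇒valid 𝔄 R10 v ρ = v (ρ 0) (ρ 1) (ρ 2)

valid⇒valid₃ : ∀ {φ} 𝔄 → ValidIn 𝔄 φ → ValidIn₃ 𝔄 φ
valid⇒valid₃ {p ≈ q} 𝔄 v x y z = v (valuation x y z)

Exhaustible : Set → Set₁
Exhaustible A = ∀ {P : A → Set} → Decidable P → Dec (∀ x → P x)

allBool? : Exhaustible Bool
allBool? P? =
  map′ (λ (f , t) → λ { false → f ; true → t }) (λ h → h false , h true)
    (P? false ×-dec P? true)

allSubset? : ∀ {n} → Exhaustible (Subset n)
allSubset? {zero}  P? = map′ (λ h → λ { [] → h }) (λ h → h []) (P? [])
allSubset? {suc n} P? =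
  map′ (λ h → λ { (b ∷ X) → h b X }) (λ h b X → h (b ∷ X))
    (allBool? λ b → allSubset? λ X → P? (b ∷ X))

module _ (𝔄 : Algebra) (all? : Exhaustible (Algebra.Carrier 𝔄))
         (_≟_ : DecidableEquality (Algebra.Carrier 𝔄)) where

  valid₃? : ∀ φ → Dec (ValidIn₃ 𝔄 φ)
  valid₃? (p ≈ q) = all? λ x → all? λ y → all? λ z →
    ⟦ p ⟧ 𝔄 (valuation x y z) ≟ ⟦ q ⟧ 𝔄 (valuation x y z)

  valid? : ∀ i → Dec (ValidIn 𝔄 (equation i))
  valid? i = map′ (valid₃⇒valid 𝔄 (proj₂ (lookup axioms i))) (valid⇒valid₃ 𝔄)
                  (valid₃? (equation i))

  separates? : ∀ i → Dec (FailsIn 𝔄 (equation i) × (∀ j → j ≢ i → ValidIn 𝔄 (equation j)))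
  separates? i =
    ¬? (valid? i) ×-dec Fin.all? λ j → ¬? (j Fin.≟ i) →-dec valid? j

  independenceModel : ∀ i → True (separates? i) → IndependenceModel 𝓡 (equation i)
  independenceModel i sep = 𝔄 , proj₁ (toWitness sep) , others
    where
    others : 𝔄 ⊨ (𝓡 ∖ equation i)
    others ψ (e , ψ≢φ) = subst (ValidIn 𝔄) eq
      -- Equal indices would give equal equations, so distinct equations have distinct indices.
      (proj₂ (toWitness sep) (index e) (ψ≢φ ∘ trans (sym eq) ∘ cong equation))
      where
      eq : equation (index e) ≡ ψ
      eq = cong proj₁ (lookup-index e)

-- A sum is its left summand, so `R10` becomes r ⨾ (r ⨾ s) = s, which holds for `_xor_`.
leftProjectionAlgebra : Algebra
leftProjectionAlgebra = record
  { Carrier = Bool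
  ; _+_ = const
  ; -_  = id
  ; _⨾_ = _xor_
  ; _˘  = id
  ; 1′  = false
  }

-- The signs −1, 0, 1, where x ⊕ y is the sign of x + y; the number i − 1 is
-- encoded as i, so that negation is opposite.
module Signs where

  _⊕_ : Fin 3 → Fin 3 → Fin 3
  1F ⊕ y  = y
  x  ⊕ 1F = x
  0F ⊕ 0F = 0F
  2F ⊕ 2F = 2F
  _  ⊕ _  = 1F

  _⊗_ : Fin 3 → Fin 3 → Fin 3
  0F ⊗ y = opposite y
  1F ⊗ y = 1F
  2F ⊗ y = y

-- Signs forget magnitude: (1 + 1) - 1 is 0, but 1 + (1 - 1) is 1. In `R10` the term added to -s is
-- -s or 0, hence absorbed.
signAlgebra : Algebra
signAlgebra = record
  { Carrier = Fin 3
  ; _+_ = Signs._⊕_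
  ; -_  = opposite
  ; _⨾_ = Signs._⊗_
  ; _˘  = id
  ; 1′  = 2F
  }

-- The constant complement makes the left side of `R3` and both sides of `R10` always `true`.
constantComplementAlgebra : Algebra
constantComplementAlgebra = record
  { Carrier = Bool
  ; _+_ = _∨_
  ; -_  = const true
  ; _⨾_ = _∧_
  ; _˘  = id
  ; 1′  = true
  }

-- The complex algebra of the partial operation on {1′, a} that is addition
-- modulo 2 with 1′ + a left undefined.  Then (a ⨾ a) ⨾ a = 1′ ⨾ a = ∅, whereas
-- a ⨾ (a ⨾ a) = a ⨾ 1′ = a.
partialGroupAlgebra : Algebra
partialGroupAlgebra = record
  { Carrier = Subset 2
  ; _+_ = _∪_
  ; -_  = ∁
  ; _⨾_ = λ { (x₀ ∷ x₁ ∷ []) (y₀ ∷ y₁ ∷ []) → ((x₀ ∧ y₀) ∨ (x₁ ∧ y₁)) ∷ (x₁ ∧ y₀) ∷ [] }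
  ; _˘  = id
  ; 1′  = true ∷ false ∷ []
  }

-- The Boolean part is kept, so `R1`, `R2` and `R3` hold for every choice of the parameters.
twoElementAlgebra : (Bool → Bool → Bool) → (Bool → Bool) → Bool → Algebra
twoElementAlgebra _·_ conv e = record
  { Carrier = Bool
  ; _+_ = _∨_
  ; -_  = not
  ; _⨾_ = _·_
  ; _˘  = conv
  ; 1′  = e
  }

-- The complex algebra of ℤ/3, twisted on the two-element sets X, for which
-- X ⨾ Y = X − Y and X ˘ = X.  The relations {(u , v) ∣ v ∈ X ⨾ {u}} are the
-- empty one, the full one, the three rotations, and the complements of the
-- three reflections; this family is closed under composition and converse, which
-- is why R4 and R10 survive, but {0} ˘ ∪ {1} ˘ = {0 , 2} while {0 , 1} ˘ = {0 , 1}.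
module TwistedℤMod3 where

  negate : Subset 3 → Subset 3
  negate (x₀ ∷ x₁ ∷ x₂ ∷ []) = x₀ ∷ x₂ ∷ x₁ ∷ []

  add : Subset 3 → Subset 3 → Subset 3
  add (x₀ ∷ x₁ ∷ x₂ ∷ []) (y₀ ∷ y₁ ∷ y₂ ∷ []) =
      ((x₀ ∧ y₀) ∨ (x₁ ∧ y₂) ∨ (x₂ ∧ y₁))
    ∷ ((x₀ ∧ y₁) ∨ (x₁ ∧ y₀) ∨ (x₂ ∧ y₂))
    ∷ ((x₀ ∧ y₂) ∨ (x₁ ∧ y₁) ∨ (x₂ ∧ y₀))
    ∷ []

  _⨾ₜ_ : Subset 3 → Subset 3 → Subset 3
  X ⨾ₜ Y = if ∣ X ∣ ≡ᵇ 2 then add X (negate Y) else add X Y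

  _˘ₜ : Subset 3 → Subset 3
  X ˘ₜ = if ∣ X ∣ ≡ᵇ 2 then X else negate X

twistedℤMod3Algebra : Algebra
twistedℤMod3Algebra = record
  { Carrier = Subset 3
  ; _+_ = _∪_
  ; -_  = ∁
  ; _⨾_ = TwistedℤMod3._⨾ₜ_
  ; _˘  = TwistedℤMod3._˘ₜ
  ; 1′  = true ∷ false ∷ false ∷ []
  }

models : ∀ φ → 𝓡 φ → IndependenceModel 𝓡 φ
models _ R1  = independenceModel leftProjectionAlgebra allBool? Bool._≟_ 0F _
models _ R2  = independenceModel signAlgebra Fin.all? Fin._≟_ 1F _
models _ R3  = independenceModel constantComplementAlgebra allBool? Bool._≟_ 2F _
models _ R4  = independenceModel partialGroupAlgebra allSubset? (≡-dec Bool._≟_) 3F _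
models _ R5  = independenceModel (twoElementAlgebra (λ _ _ → false) id true) allBool? Bool._≟_ 4F _
models _ R6  = independenceModel (twoElementAlgebra _∧_ (const false) true) allBool? Bool._≟_ 5F _
-- The biconditional is the group of order two with unit `true`. Multiplying by r is an involution
-- commuting with `not`, so `R10` reduces to -s + -s = -s.
models _ R8′ = independenceModel (twoElementAlgebra (λ x y → not (x xor y)) id true) allBool? Bool._≟_ 6F _
models _ R9  = independenceModel twistedℤMod3Algebra allSubset? (≡-dec Bool._≟_) 7F _
-- Disjunction distributes over itself, but `R10` fails at r = s = `true`.
models _ R10 = independenceModel (twoElementAlgebra _∨_ id false) allBool? Bool._≟_ 8F _

theorem3 : Independent 𝓡 × (∀ φ → 𝓡 φ → IndependenceModel 𝓡 φ)
theorem3 = models⇒independent models , models
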